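{- Let $\overrightarrow{W}$ be a Morse sequence on a simplicial complex $K$. Then there exists an arranged Morse sequence $\overrightarrow{V}$ on $K$ such that $\overrightarrow{W}$ and $\overrightarrow{V}$ are equivalent.
   Context: A simplicial complex $K$ is a finite collection of non-empty finite sets closed under taking non-empty subsets; $\dim\sigma=|\sigma|-1$. A pair $(\sigma,\tau)$ with $\sigma\subsetneq\tau$ is a free pair for $K$ if $\tau$ is the only simplex other than $\sigma$ containing $\sigma$; $K$ is then an elementary expansion of $K\setminus\{\sigma,\tau\}$. If $\nu$ is a facet (maximal simplex) of $K$, $K$ is an elementary filling of $K\setminus\{\nu\}$. A Morse sequence on $K$ is a sequence $\langle\emptyset=K_0,\dots,K_k=K\rangle$ with each $K_i$ an elementary expansion or filling of $K_{i-1}$. For each $i$, set $\kappa_i=\nu$ if $K_i=K_{i-1}\cup\{\nu\}$ is a filling ($\nu$ is then critical), and $\kappa_i=(\sigma,\tau)$ if $K_i=K_{i-1}\cup\{\sigma,\tau\}$ is an expansion with $\sigma\subset\tau$ ($(\sigma,\tau)$ is then a regular pair). The dimension of a critical simplex is its dimension; the dimension of a regular pair $(\sigma,\tau)$ is $\dim\tau$. The Morse sequence is arranged if for each $i\in[1,k-1]$: $\dim(\kappa_i)\le\dim(\kappa_{i+1})$, and $\dim(\kappa_i)<\dim(\kappa_{i+1})$ whenever $\kappa_i$ is a critical simplex and $\kappa_{i+1}$ is a regular pair. Two Morse sequences on $K$ are equivalent if they have the same set of regular pairs (gradient vector field). -}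

module Defs where

open import Data.Fin.Base using (Fin; zero; suc; inject₁; fromℕ; toℕ)
open import Data.Fin.Subset using (Subset; Nonempty; ∣_∣; _⊆_; _⊂_)
open import Data.Nat.Base using (ℕ; suc; _∸_; _≤_; _<_)
open import Data.Product.Base using (_×_; _,_; ∃-syntax)
open import Data.Sum.Base using (_⊎_)
open import Level using (0ℓ) renaming (suc to lsuc)
open import Relation.Binary.PropositionalEquality.Core using (_≡_)
open import Relation.Unary using (Pred; Decidable; _∈_; _∪_; _∖_; _≐_; ∅; ｛_｝)

-- Vertices are the elements of Fin n; n is arbitrary, and not every element
-- of Fin n has to be a vertex of a given complex.  A finite collection of
-- subsets of Fin n is a decidable predicate on Subset n.
record SimplicialComplex (n : ℕ) : Set (lsuc 0ℓ) where
  field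
    Simplex    : Pred (Subset n) 0ℓ
    simplex?   : Decidable Simplex
    nonempty   : ∀ {σ} → σ ∈ Simplex → Nonempty σ
    downClosed : ∀ {σ τ} → τ ∈ Simplex → Nonempty σ → σ ⊆ τ → σ ∈ Simplex

open SimplicialComplex public using (Simplex)

-- Truncated subtraction is harmless: simplices are non-empty.
dim : ∀ {n} → Subset n → ℕ
dim σ = ∣ σ ∣ ∸ 1

record IsFreePair {n} (K : SimplicialComplex n) (σ τ : Subset n) : Set where
  field
    σ∈K  : σ ∈ Simplex K
    τ∈K  : τ ∈ Simplex K
    σ⊂τ  : σ ⊂ τ
    only : ∀ {ρ} → ρ ∈ Simplex K → σ ⊆ ρ → ρ ≡ σ ⊎ ρ ≡ τ

record IsFacet {n} (K : SimplicialComplex n) (ν : Subset n) : Set where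
  field
    ν∈K     : ν ∈ Simplex K
    maximal : ∀ {ρ} → ρ ∈ Simplex K → ν ⊆ ρ → ρ ≡ ν

-- In both relations the second complex is the larger one, obtained from the first.
IsElementaryExpansion : ∀ {n} (L K : SimplicialComplex n) (σ τ : Subset n) → Set
IsElementaryExpansion L K σ τ =
  IsFreePair K σ τ × Simplex L ≐ (Simplex K ∖ (｛ σ ｝ ∪ ｛ τ ｝))

IsElementaryFilling : ∀ {n} (L K : SimplicialComplex n) (ν : Subset n) → Set
IsElementaryFilling L K ν =
  IsFacet K ν × Simplex L ≐ (Simplex K ∖ ｛ ν ｝)

data Step {n} (L K : SimplicialComplex n) : Set where
  filling   : ∀ ν   → IsElementaryFilling   L K ν   → Step L K
  expansion : ∀ σ τ → IsElementaryExpansion L K σ τ → Step L K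

-- The values of κᵢ.
data Label (n : ℕ) : Set where
  critical : (ν : Subset n)   → Label n
  regular  : (σ τ : Subset n) → Label n

label : ∀ {n} {L K : SimplicialComplex n} → Step L K → Label n
label (filling ν _)     = critical ν
label (expansion σ τ _) = regular σ τ

labelDim : ∀ {n} → Label n → ℕ
labelDim (critical ν)  = dim ν
labelDim (regular _ τ) = dim τ

-- Complexes are compared by extensional equality of their sets of simplices.
record MorseSequence {n} (K : SimplicialComplex n) : Set (lsuc 0ℓ) where
  field
    len   : ℕ
    stage : Fin (suc len) → SimplicialComplex n
    start : Simplex (stage zero) ≐ ∅
    end   : Simplex (stage (fromℕ len)) ≐ Simplex K
    step  : (i : Fin len) → Step (stage (inject₁ i)) (stage (suc i))

  -- Zero-based: κ i is the label of the step from stage i to stage i + 1,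
  -- i.e. κᵢ₊₁ in the usual numbering.
  κ : Fin len → Label n
  κ i = label (step i)

record IsArranged {n} {K : SimplicialComplex n} (W : MorseSequence K) : Set where
  open MorseSequence W
  field
    monotone : ∀ i j → toℕ j ≡ suc (toℕ i) → labelDim (κ i) ≤ labelDim (κ j)
    strict   : ∀ i j → toℕ j ≡ suc (toℕ i) →
               ∀ {ν σ τ} → κ i ≡ critical ν → κ j ≡ regular σ τ →
               labelDim (κ i) < labelDim (κ j)

-- The gradient vector field.
RegularPairs : ∀ {n} {K : SimplicialComplex n} →
               MorseSequence K → Pred (Subset n × Subset n) 0ℓ
RegularPairs W (σ , τ) = ∃[ i ] MorseSequence.κ W i ≡ regular σ τ

Equivalent : ∀ {n} {K : SimplicialComplex n} (W V : MorseSequence K) → Set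
Equivalent W V = RegularPairs W ≐ RegularPairs V

{-# OPTIONS --safe #-}

-- Order labels by dimension, regular pairs before critical simplices of the
-- same dimension; a sequence is arranged when its labels are sorted.  Suppose
-- two consecutive steps adding κ then κ′ are out of order.  The two simplices of
-- a regular pair differ by one vertex, so the smallest simplex of κ has at least
-- as many vertices as the largest simplex of κ′; being distinct from it, it is
-- not one of its faces.  Hence the steps can be exchanged without changing
-- their labels, and insertion sort arranges the sequence.
module Submission where

open import Defs
open import Data.Bool.Properties using () renaming (_≟_ to _≟ᵇ_)
open import Data.Empty using (⊥-elim)
open import Data.Fin.Base using (Fin; zero; suc; inject₁; fromℕ; toℕ)
open import Data.Fin.Subset using (Subset; Nonempty; ∣_∣; inside; outside; ⁅_⁆) renaming (_∈_ to _∈ᵛ_; _⊆_ to _⊆ˢ_; _⊂_ to _⊂ˢ_; _∪_ to _∪ˢ_)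
open import Data.Fin.Subset.Properties using (drop-∷-⊆; p⊆q⇒∣p∣≤∣q∣; p⊂q⇒p⊆q; ∣⁅x⁆∣≡1; x∈p⇒∣p-x∣<∣p∣; p⊆p∪q; q⊆p∪q; x∈p∪q⁻; x∈⁅x⁆; x∈⁅y⁆⇒x≡y; ⊆-refl; ⊆-trans)
open import Data.List.Base using (List; []; _∷_; length; tabulate)
open import Data.List.Membership.Propositional using () renaming (_∈_ to _∈ˡ_)
open import Data.List.Membership.Propositional.Properties using (∈-tabulate⁺; ∈-tabulate⁻)
open import Data.List.Relation.Binary.Permutation.Propositional using (_↭_; refl; prep; swap; trans; ↭-sym)
open import Data.List.Relation.Binary.Permutation.Propositional.Properties using (All-resp-↭; ∈-resp-↭)
open import Data.List.Relation.Unary.All as All using (All; []; _∷_)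
open import Data.List.Relation.Unary.All.Properties using (tabulate⁻)
open import Data.List.Relation.Unary.AllPairs using (AllPairs; []; _∷_)
open import Data.Nat.Base using (ℕ; zero; suc; _+_; _∸_; _≤_; _<_; z≤n; s≤s; s<s⁻¹)
open import Data.Nat.Properties using (_≤?_; _<?_; ≤-reflexive; ≤-trans; <-≤-trans; ≤-<-trans; <⇒≤; ≰⇒>; ≮⇒≥; +-suc; +-comm; m≤n⇒m≤1+n; <⇒≱; pred-mono-≤)
open import Data.Product.Base using (_×_; _,_; proj₁; proj₂; ∃-syntax)
open import Data.Sum.Base as Sum using (inj₁; inj₂)
open import Data.Unit.Base using (⊤; tt)
open import Data.Vec.Base using ([]; _∷_; here)
open import Data.Vec.Properties using (≡-dec)
open import Function.Base using (_∘_; case_of_)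
open import Relation.Binary.PropositionalEquality using (_≡_; refl; sym; cong; subst)
open import Relation.Nullary using (Dec; yes; no; ¬_; ¬?; _×-dec_; _⊎-dec_)
open import Relation.Unary using (Pred; Decidable; _∈_; _∪_; _∖_; _≐_; ∅; ｛_｝)

private
  variable
    n : ℕ
    κ κ′ : Label n
    L M K : SimplicialComplex n

-- Cardinalities of subsets and of free pairs.

∣p∪q∣≤∣p∣+∣q∣ : (p q : Subset n) → ∣ p ∪ˢ q ∣ ≤ ∣ p ∣ + ∣ q ∣
∣p∪q∣≤∣p∣+∣q∣ []            []            = z≤n
∣p∪q∣≤∣p∣+∣q∣ (outside ∷ p) (outside ∷ q) = ∣p∪q∣≤∣p∣+∣q∣ p q
∣p∪q∣≤∣p∣+∣q∣ (outside ∷ p) (inside  ∷ q) =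
  subst (suc ∣ p ∪ˢ q ∣ ≤_) (sym (+-suc ∣ p ∣ ∣ q ∣)) (s≤s (∣p∪q∣≤∣p∣+∣q∣ p q))
∣p∪q∣≤∣p∣+∣q∣ (inside  ∷ p) (outside ∷ q) = s≤s (∣p∪q∣≤∣p∣+∣q∣ p q)
∣p∪q∣≤∣p∣+∣q∣ (inside  ∷ p) (inside  ∷ q) =
  s≤s (subst (∣ p ∪ˢ q ∣ ≤_) (sym (+-suc ∣ p ∣ ∣ q ∣)) (m≤n⇒m≤1+n (∣p∪q∣≤∣p∣+∣q∣ p q)))

p⊆q∧∣q∣≤∣p∣⇒p≡q : {p q : Subset n} → p ⊆ˢ q → ∣ q ∣ ≤ ∣ p ∣ → p ≡ q
p⊆q∧∣q∣≤∣p∣⇒p≡q {p = []}          {[]}          _   _ = refl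
p⊆q∧∣q∣≤∣p∣⇒p≡q {p = outside ∷ p} {outside ∷ q} p⊆q q≤p =
  cong (outside ∷_) (p⊆q∧∣q∣≤∣p∣⇒p≡q (drop-∷-⊆ p⊆q) q≤p)
p⊆q∧∣q∣≤∣p∣⇒p≡q {p = outside ∷ p} {inside  ∷ q} p⊆q q≤p =
  ⊥-elim (<⇒≱ q≤p (p⊆q⇒∣p∣≤∣q∣ (drop-∷-⊆ p⊆q)))
p⊆q∧∣q∣≤∣p∣⇒p≡q {p = inside  ∷ p} {outside ∷ q} p⊆q q≤p = case p⊆q here of λ ()
p⊆q∧∣q∣≤∣p∣⇒p≡q {p = inside  ∷ p} {inside  ∷ q} p⊆q (s≤s q≤p) =
  cong (inside ∷_) (p⊆q∧∣q∣≤∣p∣⇒p≡q (drop-∷-⊆ p⊆q) q≤p)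

nonempty⇒0<∣p∣ : {p : Subset n} → Nonempty p → 0 < ∣ p ∣
nonempty⇒0<∣p∣ (_ , x∈p) = ≤-<-trans z≤n (x∈p⇒∣p-x∣<∣p∣ x∈p)

-- For `x` in `τ` but not in `σ`, the set `σ ∪ˢ ⁅ x ⁆` is a face of `τ`, hence a simplex, and
-- properly contains `σ`; freeness then forces it to be `τ`.
free-pair-card : ∀ {σ τ} → IsFreePair K σ τ → ∣ τ ∣ ≤ suc ∣ σ ∣
free-pair-card {K = K} {σ} {τ} free with IsFreePair.σ⊂τ free
... | σ⊆τ , x , x∈τ , x∉σ = case only ρ∈K (p⊆p∪q ⁅ x ⁆) of λ where
    (inj₁ ρ≡σ) → ⊥-elim (x∉σ (subst (x ∈ᵛ_) ρ≡σ x∈ρ))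
    (inj₂ ρ≡τ) → subst (λ π → ∣ π ∣ ≤ suc ∣ σ ∣) ρ≡τ ∣ρ∣≤
  where
  open IsFreePair free
  open SimplicialComplex K using (downClosed)

  ρ : Subset _
  ρ = σ ∪ˢ ⁅ x ⁆

  x∈ρ : x ∈ᵛ ρ
  x∈ρ = q⊆p∪q σ ⁅ x ⁆ (x∈⁅x⁆ x)

  ρ⊆τ : ρ ⊆ˢ τ
  ρ⊆τ y∈ρ with x∈p∪q⁻ σ ⁅ x ⁆ y∈ρ
  ... | inj₁ y∈σ = σ⊆τ y∈σ
  ... | inj₂ y∈x rewrite x∈⁅y⁆⇒x≡y x y∈x = x∈τ

  ρ∈K : ρ ∈ Simplex K
  ρ∈K = downClosed τ∈K (x , x∈ρ) ρ⊆τ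

  ∣ρ∣≤ : ∣ ρ ∣ ≤ suc ∣ σ ∣
  ∣ρ∣≤ = ≤-trans (∣p∪q∣≤∣p∣+∣q∣ σ ⁅ x ⁆)
    (≤-reflexive (subst (λ k → ∣ σ ∣ + k ≡ suc ∣ σ ∣) (sym (∣⁅x⁆∣≡1 x)) (+-comm ∣ σ ∣ 1)))

-- Elementary steps in a uniform form, and their exchange.

bottom top : Label n → Subset n
bottom (critical ν)  = ν
bottom (regular σ _) = σ
top (critical ν)  = ν
top (regular _ τ) = τ

Added : Label n → Pred (Subset n) _
Added (critical ν)  = ｛ ν ｝
Added (regular σ τ) = ｛ σ ｝ ∪ ｛ τ ｝

Proper : Label n → Set
Proper (critical _)  = ⊤
Proper (regular σ τ) = σ ⊂ˢ τ

added? : (κ : Label n) → Decidable (Added κ)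
added? (critical ν)  ρ = ≡-dec _≟ᵇ_ ν ρ
added? (regular σ τ) ρ = ≡-dec _≟ᵇ_ σ ρ ⊎-dec ≡-dec _≟ᵇ_ τ ρ

bottom∈Added : (κ : Label n) → bottom κ ∈ Added κ
bottom∈Added (critical _)  = refl
bottom∈Added (regular _ _) = inj₁ refl

top∈Added : (κ : Label n) → top κ ∈ Added κ
top∈Added (critical _)  = refl
top∈Added (regular _ _) = inj₂ refl

bottom⊆added : ∀ {ρ} → Proper κ → ρ ∈ Added κ → bottom κ ⊆ˢ ρ
bottom⊆added {κ = critical _}  _   refl        = ⊆-refl
bottom⊆added {κ = regular _ _} _   (inj₁ refl) = ⊆-refl
bottom⊆added {κ = regular _ _} σ⊂τ (inj₂ refl) = p⊂q⇒p⊆q σ⊂τ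

added⊆top : ∀ {ρ} → Proper κ → ρ ∈ Added κ → ρ ⊆ˢ top κ
added⊆top {κ = critical _}  _   refl        = ⊆-refl
added⊆top {κ = regular _ _} σ⊂τ (inj₁ refl) = p⊂q⇒p⊆q σ⊂τ
added⊆top {κ = regular _ _} _   (inj₂ refl) = ⊆-refl

-- A critical simplex is treated as a degenerate pair with `bottom` equal to `top`, so `only`
-- expresses both maximality of a facet and freeness of a pair. The exchange argument then needs no
-- case split on the kinds of the two steps.
record Adds (κ : Label n) (L K : SimplicialComplex n) : Set where
  field
    proper  : Proper κ
    added∈K : ∀ {ρ} → ρ ∈ Added κ → ρ ∈ Simplex K
    only    : ∀ {ρ} → ρ ∈ Simplex K → bottom κ ⊆ˢ ρ → ρ ∈ Added κ
    removal : Simplex L ≐ (Simplex K ∖ Added κ)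

step⇒adds : (s : Step L K) → Adds (label s) L K
step⇒adds (filling ν (facet , removal)) = record
  { proper  = tt
  ; added∈K = λ { refl → IsFacet.ν∈K facet }
  ; only    = λ ρ∈K ν⊆ρ → sym (IsFacet.maximal facet ρ∈K ν⊆ρ)
  ; removal = removal
  }
step⇒adds (expansion σ τ (free , removal)) = record
  { proper  = IsFreePair.σ⊂τ free
  ; added∈K = λ { (inj₁ refl) → IsFreePair.σ∈K free ; (inj₂ refl) → IsFreePair.τ∈K free }
  ; only    = λ ρ∈K σ⊆ρ → Sum.map sym sym (IsFreePair.only free ρ∈K σ⊆ρ)
  ; removal = removal
  }

adds⇒freePair : ∀ {σ τ} → Adds (regular σ τ) L K → IsFreePair K σ τ
adds⇒freePair a = record
  { σ∈K  = added∈K (inj₁ refl)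
  ; τ∈K  = added∈K (inj₂ refl)
  ; σ⊂τ  = proper
  ; only = λ ρ∈K σ⊆ρ → Sum.map sym sym (only ρ∈K σ⊆ρ)
  }
  where open Adds a

adds⇒step : Adds κ L K → Step L K
adds⇒step {κ = critical ν} a = filling ν
  (record { ν∈K = added∈K refl ; maximal = λ ρ∈K ν⊆ρ → sym (only ρ∈K ν⊆ρ) } , removal)
  where open Adds a
adds⇒step {κ = regular σ τ} a = expansion σ τ (adds⇒freePair a , Adds.removal a)

label-adds⇒step : (a : Adds κ L K) → label (adds⇒step a) ≡ κ
label-adds⇒step {κ = critical _}  _ = refl
label-adds⇒step {κ = regular _ _} _ = refl

-- Removing κ first leaves a complex because no simplex of κ is a face of one of κ′.
adds-swap : Adds κ L M → Adds κ′ M K → ¬ (bottom κ ⊆ˢ top κ′) →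
            ∃[ M′ ] (Adds κ′ L M′ × Adds κ M′ K)
adds-swap {κ = κ} {L = L} {M = M} {κ′ = κ′} {K = K} a a′ κ⊈κ′ = M′ , a′-first , a-second
  where
  module A  = Adds a
  module A′ = Adds a′
  open SimplicialComplex K

  M⇒K : ∀ {ρ} → ρ ∈ Simplex M → ρ ∈ Simplex K
  M⇒K = proj₁ ∘ proj₁ A′.removal

  -- A coface of `bottom κ` lying in `κ′` would put `bottom κ` below `top κ′`. Every coface in `K`
  -- is therefore already in `M`, where `A.only` applies.
  only-in-K : ∀ {ρ} → ρ ∈ Simplex K → bottom κ ⊆ˢ ρ → ρ ∈ Added κ
  only-in-K {ρ} ρ∈K κ⊆ρ with added? κ′ ρ
  ... | yes ρ∈κ′ = ⊥-elim (κ⊈κ′ (⊆-trans κ⊆ρ (added⊆top A′.proper ρ∈κ′)))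
  ... | no  ρ∉κ′ = A.only (proj₂ A′.removal (ρ∈K , ρ∉κ′)) κ⊆ρ

  M′ : SimplicialComplex _
  M′ = record
    { Simplex    = Simplex K ∖ Added κ
    ; simplex?   = λ ρ → simplex? ρ ×-dec ¬? (added? κ ρ)
    ; nonempty   = nonempty ∘ proj₁
    ; downClosed = λ (τ∈K , τ∉κ) σ≠∅ σ⊆τ → downClosed τ∈K σ≠∅ σ⊆τ ,
        λ σ∈κ → τ∉κ (only-in-K τ∈K (⊆-trans (bottom⊆added A.proper σ∈κ) σ⊆τ))
    }

  a′-first : Adds κ′ L M′
  a′-first = record
    { proper  = A′.proper
    ; added∈K = λ ρ∈κ′ → A′.added∈K ρ∈κ′ ,
        -- A simplex of `κ` is already in `M`, which contains nothing of `κ′`.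
        λ ρ∈κ → proj₂ (proj₁ A′.removal (A.added∈K ρ∈κ)) ρ∈κ′
    ; only    = A′.only ∘ proj₁
    ; removal =
        (λ ρ∈L → let (ρ∈M , ρ∉κ) = proj₁ A.removal ρ∈L
                     (ρ∈K , ρ∉κ′) = proj₁ A′.removal ρ∈M
                 in (ρ∈K , ρ∉κ) , ρ∉κ′) ,
        (λ ((ρ∈K , ρ∉κ) , ρ∉κ′) → proj₂ A.removal (proj₂ A′.removal (ρ∈K , ρ∉κ′) , ρ∉κ))
    }

  a-second : Adds κ M′ K
  a-second = record
    { proper  = A.proper
    ; added∈K = M⇒K ∘ A.added∈K
    ; only    = only-in-K
    ; removal = (λ ρ∈M′ → ρ∈M′) , (λ ρ∈M′ → ρ∈M′)
    }

-- The order on labels.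

infix 4 _≼_

-- For neighbouring labels this is the conjunction of the two conditions of `IsArranged`. It is a
-- total preorder: distinct labels of equal kind and dimension precede each other.
_≼_ : Label n → Label n → Set
critical ν  ≼ critical ν′   = dim ν ≤ dim ν′
critical ν  ≼ regular _ τ′  = dim ν < dim τ′
regular _ τ ≼ critical ν′   = dim τ ≤ dim ν′
regular _ τ ≼ regular _ τ′  = dim τ ≤ dim τ′

_≼?_ : (κ κ′ : Label n) → Dec (κ ≼ κ′)
critical _  ≼? critical _  = _ ≤? _
critical _  ≼? regular _ _ = _ <? _
regular _ _ ≼? critical _  = _ ≤? _
regular _ _ ≼? regular _ _ = _ ≤? _

≼-trans : (κ κ′ κ″ : Label n) → κ ≼ κ′ → κ′ ≼ κ″ → κ ≼ κ″
≼-trans (critical _)  (critical _)  (critical _)  p q = ≤-trans p q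
≼-trans (critical _)  (critical _)  (regular _ _) p q = ≤-<-trans p q
≼-trans (critical _)  (regular _ _) (critical _)  p q = ≤-trans (<⇒≤ p) q
≼-trans (critical _)  (regular _ _) (regular _ _) p q = <-≤-trans p q
≼-trans (regular _ _) (critical _)  (critical _)  p q = ≤-trans p q
≼-trans (regular _ _) (critical _)  (regular _ _) p q = ≤-trans p (<⇒≤ q)
≼-trans (regular _ _) (regular _ _) (critical _)  p q = ≤-trans p q
≼-trans (regular _ _) (regular _ _) (regular _ _) p q = ≤-trans p q

⋠⇒≽ : (κ κ′ : Label n) → ¬ κ ≼ κ′ → κ′ ≼ κ
⋠⇒≽ (critical _)  (critical _)  κ⋠κ′ = <⇒≤ (≰⇒> κ⋠κ′)
⋠⇒≽ (critical _)  (regular _ _) κ⋠κ′ = ≮⇒≥ κ⋠κ′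
⋠⇒≽ (regular _ _) (critical _)  κ⋠κ′ = ≰⇒> κ⋠κ′
⋠⇒≽ (regular _ _) (regular _ _) κ⋠κ′ = <⇒≤ (≰⇒> κ⋠κ′)

≼⇒labelDim≤ : (κ κ′ : Label n) → κ ≼ κ′ → labelDim κ ≤ labelDim κ′
≼⇒labelDim≤ (critical _)  (critical _)  p = p
≼⇒labelDim≤ (critical _)  (regular _ _) p = <⇒≤ p
≼⇒labelDim≤ (regular _ _) (critical _)  p = p
≼⇒labelDim≤ (regular _ _) (regular _ _) p = p

-- From labels out of order to the absence of a face relation.

m∸1<n⇒m≤n : ∀ {m n} → m ∸ 1 < n → m ≤ n
m∸1<n⇒m≤n {zero}  _ = z≤n
m∸1<n⇒m≤n {suc _} p = p

-- Positivity of `n` rules out `m = 1`, `n = 0`, where truncation makes both sides zero.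
m∸1≤n∸1⇒m≤n : ∀ {m n} → 0 < n → m ∸ 1 ≤ n ∸ 1 → m ≤ n
m∸1≤n∸1⇒m≤n {n = suc _} _ p = m∸1<n⇒m≤n (s≤s p)

m∸1<n∸1⇒m≤n : ∀ {m n} → m ∸ 1 < n ∸ 1 → m ≤ n
m∸1<n∸1⇒m≤n {n = suc _} p = m≤n⇒m≤1+n (m∸1<n⇒m≤n p)

-- If `κ` is a pair `(σ , τ)`, then `top κ′` has dimension below `dim τ`, which is at most `∣ σ ∣`
-- by `free-pair-card`. If `κ` is critical, dimensions compare directly; against a regular pair the
-- inequality is only weak, so non-emptiness of the critical simplex is used.
⋠⇒∣top∣≤∣bottom∣ : Adds κ L K → (κ′ : Label n) → ¬ κ ≼ κ′ → ∣ top κ′ ∣ ≤ ∣ bottom κ ∣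
⋠⇒∣top∣≤∣bottom∣ {κ = critical _} a (critical _) κ⋠κ′ = m∸1<n∸1⇒m≤n (≰⇒> κ⋠κ′)
⋠⇒∣top∣≤∣bottom∣ {κ = critical _} {K = K} a (regular _ _) κ⋠κ′ =
  m∸1≤n∸1⇒m≤n (nonempty⇒0<∣p∣ (SimplicialComplex.nonempty K (Adds.added∈K a refl))) (≮⇒≥ κ⋠κ′)
⋠⇒∣top∣≤∣bottom∣ {κ = regular _ _} a (critical _) κ⋠κ′ =
  m∸1<n⇒m≤n (<-≤-trans (≰⇒> κ⋠κ′) (pred-mono-≤ (free-pair-card (adds⇒freePair a))))
⋠⇒∣top∣≤∣bottom∣ {κ = regular _ _} a (regular _ _) κ⋠κ′ =
  m∸1<n⇒m≤n (<-≤-trans (≰⇒> κ⋠κ′) (pred-mono-≤ (free-pair-card (adds⇒freePair a))))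

-- By cardinality an inclusion would be an equality, but `bottom κ` is in `M` while `top κ′` is
-- added only after `M`.
⋠⇒bottom⊈top : Adds κ L M → Adds κ′ M K → ¬ κ ≼ κ′ → ¬ (bottom κ ⊆ˢ top κ′)
⋠⇒bottom⊈top {κ = κ} {M = M} {κ′ = κ′} a a′ κ⋠κ′ κ⊆κ′ =
  proj₂ (proj₁ (Adds.removal a′) top∈M) (top∈Added κ′)
  where
  top∈M : top κ′ ∈ Simplex M
  top∈M = subst (Simplex M)
    (p⊆q∧∣q∣≤∣p∣⇒p≡q κ⊆κ′ (⋠⇒∣top∣≤∣bottom∣ a κ′ κ⋠κ′))
    (Adds.added∈K a (bottom∈Added κ))

-- Insertion sort on sequences of steps.

infixr 5 _∷_

-- The label list is an index and the intermediate complexes are hidden in the constructors, so an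
-- exchange can replace one complex without reindexing a family over `Fin`.
data Path {n} : SimplicialComplex n → List (Label n) → SimplicialComplex n → Set₁ where
  []  : Path K [] K
  _∷_ : ∀ {κs} → Adds κ L M → Path M κs K → Path L (κ ∷ κs) K

Sorted : List (Label n) → Set
Sorted = AllPairs _≼_

insert : ∀ {κs} → Adds κ L M → Path M κs K → Sorted κs →
         ∃[ κs′ ] (Path L κs′ K × κs′ ↭ κ ∷ κs × Sorted κs′)
insert a [] [] = _ , a ∷ [] , refl , [] ∷ []
insert {κ = κ} a (_∷_ {κ = κ′} a′ P) (κ′≼ ∷ sorted) with κ ≼? κ′
... | yes κ≼κ′ = _ , a ∷ a′ ∷ P , refl ,
  (κ≼κ′ ∷ All.map (λ {κ″} → ≼-trans κ κ′ κ″ κ≼κ′) κ′≼) ∷ κ′≼ ∷ sorted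
... | no κ⋠κ′ =
  -- The exchange changes only the complex between the two steps, so `b` still ends where `P` starts
  -- and can be inserted further down.
  let (_ , b′ , b) = adds-swap a a′ (⋠⇒bottom⊈top a a′ κ⋠κ′)
      (_ , Q , perm , sortedQ) = insert b P sorted
  in _ , b′ ∷ Q , trans (prep κ′ perm) (swap κ′ κ refl) ,
     -- The new head `κ′` precedes `κ` by totality and the old tail by sortedness; the permutation
     -- carries this over to the new tail.
     All-resp-↭ (↭-sym perm) (⋠⇒≽ κ κ′ κ⋠κ′ ∷ κ′≼) ∷ sortedQ

sort : ∀ {κs} → Path L κs K → ∃[ κs′ ] (Path L κs′ K × κs′ ↭ κs × Sorted κs′)
sort [] = _ , [] , refl , []
sort (a ∷ P) =
  let (_ , Q , perm , sortedQ) = sort P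
      (_ , R , perm′ , sortedR) = insert a Q sortedQ
  in _ , R , trans perm′ (prep _ perm) , sortedR

-- Translation between Morse sequences and paths.

steps⇒path : ∀ m (stage : Fin (suc m) → SimplicialComplex n)
             (step : ∀ i → Step (stage (inject₁ i)) (stage (suc i))) →
             Path (stage zero) (tabulate (label ∘ step)) (stage (fromℕ m))
steps⇒path zero    stage step = []
steps⇒path (suc m) stage step =
  step⇒adds (step zero) ∷ steps⇒path m (stage ∘ suc) (step ∘ suc)

stages : ∀ {κs} → Path L κs K → Fin (suc (length κs)) → SimplicialComplex _
stages {L = L} _ zero    = L
stages (_ ∷ P)   (suc i) = stages P i

last-stage : ∀ {κs} (P : Path L κs K) → stages P (fromℕ (length κs)) ≡ K
last-stage []      = refl
last-stage (_ ∷ P) = last-stage P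

steps : ∀ {κs} (P : Path L κs K) (i : Fin (length κs)) →
        Step (stages P (inject₁ i)) (stages P (suc i))
steps (a ∷ P) zero    = adds⇒step a
steps (_ ∷ P) (suc i) = steps P i

labels-steps : ∀ {κs} (P : Path L κs K) → tabulate (label ∘ steps P) ≡ κs
labels-steps []      = refl
labels-steps (a ∷ P) rewrite label-adds⇒step a = cong (_ ∷_) (labels-steps P)

-- The target `K′` is separate from `K` because the last stage of a Morse sequence agrees with its
-- complex only extensionally.
path⇒morse : ∀ {κs} {K′ : SimplicialComplex n} → Path L κs K → Simplex L ≐ ∅ →
             Simplex K ≐ Simplex K′ → MorseSequence K′
path⇒morse P L≐∅ K≐K′ = record
  { len   = _
  ; stage = stages P
  ; start = L≐∅
  ; end   = subst (λ J → Simplex J ≐ _) (sym (last-stage P)) K≐K′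
  ; step  = steps P
  }

labels : MorseSequence K → List (Label _)
labels W = tabulate (MorseSequence.κ W)

AllPairs-tabulate⁻ : ∀ {a r} {A : Set a} {R : A → A → Set r} {m} {f : Fin m → A} →
                     AllPairs R (tabulate f) → ∀ i j → toℕ i < toℕ j → R (f i) (f j)
AllPairs-tabulate⁻ (fz∼ ∷ _) zero    (suc j) _   = tabulate⁻ fz∼ j
AllPairs-tabulate⁻ (_ ∷ f∼)  (suc i) (suc j) i<j = AllPairs-tabulate⁻ f∼ i j (s<s⁻¹ i<j)

sorted⇒arranged : (W : MorseSequence K) → Sorted (labels W) → IsArranged W
sorted⇒arranged W sorted = record
  { monotone = λ i j j≡1+i → ≼⇒labelDim≤ (κᵂ i) (κᵂ j) (consecutive i j j≡1+i)
  ; strict   = λ i j j≡1+i κi≡ κj≡ →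
      critical≼regular⇒< κi≡ κj≡ (consecutive i j j≡1+i)
  }
  where
  open MorseSequence W using () renaming (κ to κᵂ)

  consecutive : ∀ i j → toℕ j ≡ suc (toℕ i) → κᵂ i ≼ κᵂ j
  consecutive i j j≡1+i = AllPairs-tabulate⁻ sorted i j (≤-reflexive (sym j≡1+i))

  -- The labels are generalised to variables so that both equations can be matched with `refl` and
  -- `≼` reduces to the strict inequality.
  critical≼regular⇒< : ∀ {l l′ : Label _} {ν σ τ} → l ≡ critical ν → l′ ≡ regular σ τ →
                       l ≼ l′ → labelDim l < labelDim l′
  critical≼regular⇒< refl refl p = p

-- A pair is regular exactly when its label occurs in the list of labels, and occurrence is
-- invariant under permutation.
labels-↭⇒⊆ : (W V : MorseSequence K) → labels W ↭ labels V →
             ∀ {p} → p ∈ RegularPairs W → p ∈ RegularPairs V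
labels-↭⇒⊆ W V perm (i , κi≡) =
  let (j , ≡κj) = ∈-tabulate⁻ (∈-resp-↭ perm (subst (_∈ˡ labels W) κi≡ (∈-tabulate⁺ i)))
  in j , sym ≡κj

labels-↭⇒equivalent : (W V : MorseSequence K) → labels W ↭ labels V → Equivalent W V
labels-↭⇒equivalent W V perm = labels-↭⇒⊆ W V perm , labels-↭⇒⊆ V W (↭-sym perm)

theorem5 : ∀ (n : ℕ) (K : SimplicialComplex n) (W : MorseSequence K) → ∃[ V ] (IsArranged {n} {K} V × Equivalent W V)
theorem5 n K W with sort (steps⇒path len stage step)
  where open MorseSequence W
... | κs , P , perm , sorted = V , sorted⇒arranged V (subst Sorted (sym labels≡) sorted) ,
    labels-↭⇒equivalent W V (subst (labels W ↭_) (sym labels≡) (↭-sym perm))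
  where
  V : MorseSequence K
  V = path⇒morse P (MorseSequence.start W) (MorseSequence.end W)

  labels≡ : labels V ≡ κs
  labels≡ = labels-steps P
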